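{- For integers $n\ge2$ and $0\le t\le n-2$, the number of $(102,021)$-avoiding inversion sequences $e$ of length $n$ with $\mathrm{rank}(e)=t$ is $$(t+1)\left(2^{n-t-2}-(n-t-1)+\sum_{m=1}^{n-t-1}\frac{1}{m+t+1}\binom{2m+t}{m}\right).$$
   Context: An inversion sequence of length $n$ is an integer sequence $e=(e_1,\dots,e_n)$ with $0\le e_j\le j-1$ for all $j$. It contains a pattern $w=w_1w_2w_3$ if there are indices $i_1<i_2<i_3$ such that $e_{i_1}e_{i_2}e_{i_3}$ is order-isomorphic to $w$ (same relations $<,=,>$ between corresponding pairs of entries); otherwise it avoids $w$. "$(w,w')$-avoiding" means avoiding both $w$ and $w'$. $\max(e)$ is the largest entry, and $\mathrm{fdes}(e)$ is the position $p$ of the first descent: $e_1\le\cdots\le e_p>e_{p+1}$, with the convention $e_{n+1}=-1$. For a $102$-avoiding $e$, $\mathrm{rank}(e):=\mathrm{fdes}(e)-\max(e)-1$. -}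

module Defs where

open import Data.Bool.Base using (if_then_else_)
open import Data.Fin.Base as Fin using (Fin; toℕ)
open import Data.Integer.Base as ℤ using (ℤ; +_)
open import Data.List.Base using (length)
open import Data.List.Membership.Propositional using (_∈_)
open import Data.List.Relation.Unary.Unique.Propositional using (Unique)
open import Data.Nat.Base using (ℕ; zero; suc; _≤_; _<_; _≤ᵇ_; _⊔_)
open import Data.Product.Base using (∃-syntax; _×_)
open import Data.Rational.Base as ℚ using (ℚ; 0ℚ)
open import Data.Vec.Base using (Vec; []; _∷_; lookup; foldr′)
open import Function.Bundles using (_⇔_)
open import Relation.Binary.PropositionalEquality.Core using (_≡_)
open import Relation.Nullary.Negation.Core using (¬_)

private
  variable
    n k : ℕ

-- Positions are 0-based: index j stands for position j + 1, so the bound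
-- e_{j+1} ≤ (j+1) - 1 reads as follows.
IsInversionSequence : Vec ℕ n → Set
IsInversionSequence e = ∀ j → lookup e j ≤ toℕ j

-- The relation > is covered by exchanging a and b.
OrderIsomorphic : Vec ℕ k → Vec ℕ k → Set
OrderIsomorphic u v = ∀ a b →
  (lookup u a < lookup u b ⇔ lookup v a < lookup v b) ×
  (lookup u a ≡ lookup u b ⇔ lookup v a ≡ lookup v b)

Contains : Vec ℕ n → Vec ℕ 3 → Set
Contains e w = ∃[ i₁ ] ∃[ i₂ ] ∃[ i₃ ]
  i₁ Fin.< i₂ × i₂ Fin.< i₃ ×
  OrderIsomorphic (lookup e i₁ ∷ lookup e i₂ ∷ lookup e i₃ ∷ []) w

Avoids : Vec ℕ n → Vec ℕ 3 → Set
Avoids e w = ¬ Contains e w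

-- 0 is neutral here since entries are natural numbers.
maxEntry : Vec ℕ n → ℕ
maxEntry = foldr′ _⊔_ 0

-- The (1-based) position of the first descent.  The one-entry case is the
-- convention e_{n+1} = -1: the last position is always a descent.
fdes : Vec ℕ n → ℕ
fdes []           = 0
fdes (x ∷ [])     = 1
fdes (x ∷ y ∷ xs) = if x ≤ᵇ y then suc (fdes (y ∷ xs)) else 1

-- Integer-valued, so that no subtraction is truncated.
rank : Vec ℕ n → ℤ
rank e = + fdes e ℤ.- + maxEntry e ℤ.- + 1

-- Exactly k elements satisfy P: some duplicate-free list of length k
-- consists of precisely these elements.
HasCardinality : {A : Set} → (A → Set) → ℕ → Set
HasCardinality {A} P k = ∃[ xs ]
  Unique xs × (∀ (x : A) → x ∈ xs ⇔ P x) × length xs ≡ k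

-- f 1 + f 2 + ⋯ + f N
sumFrom1To : ℕ → (ℕ → ℚ) → ℚ
sumFrom1To zero    f = 0ℚ
sumFrom1To (suc N) f = sumFrom1To N f ℚ.+ f (suc N)

{-# OPTIONS --safe #-}
module Submission where

-- Since e₁ = 0, avoiding 021 means that the nonzero entries increase weakly, and
-- avoiding 102 then says that an entry which is preceded by a descent to 0 is 0
-- or equals every earlier nonzero entry.  Hence a nonzero avoider of length n
-- and rank t is either weakly increasing with last entry n - t - 1, or an avoider of
-- length n - 1 followed by 0, or a word 0 … 0 x … x 0 w in {0, x} followed by x.
-- The first kind is counted by the ballot number (t+1)/(m+t+1) C(2m+t, m) with
-- m = n - t - 1, and the third by (t+1)(2^(n-t-3) - 1) if n ≥ t + 3 (by 0 if
-- n = t + 2), because t + 1 blocks 0 … 0 x … x of each length ≥ t + 2 have rank t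
-- and w is arbitrary.

open import Defs
open import Data.Bool.Base as Bool using (true; false)
open import Data.Empty using (⊥-elim)
open import Data.Fin.Base as Fin using (Fin; zero; suc; toℕ; fromℕ; inject₁; opposite)
open import Data.Fin.Properties
  using (toℕ-inject₁; toℕ-fromℕ; toℕ≤pred[n]; toℕ<n; toℕ-injective; opposite-prop; opposite-involutive)
open import Data.Integer.Base as ℤ using (+_)
import Data.Integer.Properties as ℤ
open import Data.Integer.Tactic.RingSolver using () renaming (solve-∀ to ℤ-solve-∀)
open import Data.List.Base as List using ([]; _∷_; _++_)
open import Data.List.Membership.Propositional using (_∈_)
open import Data.List.Membership.Propositional.Properties
  using (∈-map⁺; ∈-map⁻; ∈-++⁺ˡ; ∈-++⁺ʳ; ∈-++⁻)
open import Data.List.Properties using (length-map; length-++)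
open import Data.List.Relation.Unary.All using ([])
open import Data.List.Relation.Unary.AllPairs using ([]; _∷_)
open import Data.List.Relation.Unary.Any using (here)
open import Data.List.Relation.Unary.Unique.Propositional.Properties using (map⁺; ++⁺)
open import Data.Nat.Base hiding (_/_)
open import Data.Nat.Combinatorics using (_C_; nCk+nC[k+1]≡[n+1]C[k+1]; nCk≡nC[n∸k]; nC1≡n)
open import Data.Nat.Properties
open import Data.Nat.Tactic.RingSolver using (solve-∀)
open import Data.Product.Base using (∃-syntax; _×_; _,_; proj₁; proj₂)
open import Data.Rational.Base as ℚ using (ℚ; 0ℚ; 1ℚ; _/_; toℚᵘ)
open import Data.Rational.Literals using (fromℤ)
import Data.Rational.Properties as ℚ
open import Data.Rational.Solver using (module +-*-Solver)
open import Data.Rational.Unnormalised.Base using (mkℚᵘ; *≡*)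
import Data.Rational.Unnormalised.Properties as ℚᵘ
open import Data.Sum.Base as Sum using (_⊎_; inj₁; inj₂)
open import Data.Vec.Base using (Vec; []; _∷_; _∷ʳ_; lookup; replicate; reverse)
open import Data.Vec.Properties
  using (∷-injectiveʳ; lookup-replicate; reverse-∷; reverse-involutive; reverse-injective)
open import Function.Bundles using (_⇔_; mk⇔; Equivalence)
open import Function.Definitions using (Injective)
open import Relation.Binary.PropositionalEquality
open import Relation.Nullary.Decidable.Core using (yes; no)
open import Relation.Nullary.Negation.Core using (¬_)

open Equivalence using (to; from)

private
  variable
    A B : Set
    P Q : A → Set
    k l m n t x y : ℕ
    r : Vec ℕ n

-- Cardinalities of predicates

cardinality-⇔ : (∀ x → P x ⇔ Q x) → HasCardinality P k → HasCardinality Q k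
cardinality-⇔ eq (xs , u , mem , len) =
  xs , u , (λ x → mk⇔ (λ x∈ → to (eq x) (to (mem x) x∈)) (λ q → from (mem x) (from (eq x) q))) , len

cardinality-∅ : (∀ (x : A) → ¬ P x) → HasCardinality P 0
cardinality-∅ none = [] , [] , (λ x → mk⇔ (λ ()) (λ p → ⊥-elim (none x p))) , refl

cardinality-singleton : (a : A) → P a → (∀ x → P x → x ≡ a) → HasCardinality P 1
cardinality-singleton a pa only =
  a ∷ [] , [] ∷ [] , (λ x → mk⇔ (λ { (here refl) → pa }) (λ p → here (only x p))) , refl

Image : (A → B) → (A → Set) → B → Set
Image f P y = ∃[ x ] P x × y ≡ f x

cardinality-image : {P : A → Set} {f : A → B} → Injective _≡_ _≡_ f →
  HasCardinality P k → HasCardinality (Image f P) k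
cardinality-image {P = P} {f = f} inj (xs , u , mem , len) =
  List.map f xs , map⁺ inj u , (λ y → mk⇔ (there y) (back y)) , trans (length-map f xs) len
  where
  there : ∀ y → y ∈ List.map f xs → Image f P y
  there y y∈ with x , x∈ , eq ← ∈-map⁻ f y∈ = x , to (mem x) x∈ , eq
  back : ∀ y → Image f P y → y ∈ List.map f xs
  back _ (x , p , refl) = ∈-map⁺ f (from (mem x) p)

cardinality-⊎ : {P Q : A → Set} → (∀ x → P x → ¬ Q x) →
  HasCardinality P k → HasCardinality Q l → HasCardinality (λ x → P x ⊎ Q x) (k + l)
cardinality-⊎ {P = P} {Q = Q} disj (xs , u , mem , len) (ys , v , mem′ , len′) =
  xs ++ ys
  , ++⁺ u v (λ { (x∈ , y∈) → disj _ (to (mem _) x∈) (to (mem′ _) y∈) })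
  , (λ x → mk⇔ (split x) (join x))
  , trans (length-++ xs) (cong₂ _+_ len len′)
  where
  split : ∀ x → x ∈ xs ++ ys → P x ⊎ Q x
  split x x∈ with ∈-++⁻ xs x∈
  ... | inj₁ ∈xs = inj₁ (to (mem x) ∈xs)
  ... | inj₂ ∈ys = inj₂ (to (mem′ x) ∈ys)
  join : ∀ x → P x ⊎ Q x → x ∈ xs ++ ys
  join x (inj₁ p) = ∈-++⁺ˡ (from (mem x) p)
  join x (inj₂ q) = ∈-++⁺ʳ xs (from (mem′ x) q)

-- An inversion sequence is handled through its reversal, so that consing
-- appends an entry at its right end.  Reversals of weakly increasing inversion
-- sequences with last entry m, generated like lattice paths below the diagonal:
data Mono : ℕ → Vec ℕ n → Set where
  start : Mono 0 (0 ∷ [])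
  stay  : Mono m r → Mono m (m ∷ r)
  rise  : {r : Vec ℕ n} → Mono m (m ∷ r) → suc m ≤ n → Mono (suc m) (suc m ∷ r)

-- Reversals of 0 … 0 x … x.
data Block : ℕ → Vec ℕ n → Set where
  base : 1 ≤ x → x ≤ n → Block x (x ∷ replicate n 0)
  more : Block x r → Block x (x ∷ r)

-- Reversals of the sequences of rank t of the form 0 … 0 x … x 0 w, where w is
-- a word in 0 and x.
data TwoValued (t : ℕ) : Vec ℕ n → Set where
  drop : {r : Vec ℕ n} → n ≡ x + suc t → Block x r → TwoValued t (0 ∷ r)
  zero : TwoValued t r → TwoValued t (0 ∷ r)
  peak : TwoValued t r → TwoValued t (maxEntry r ∷ r)

-- Reversals of the nonzero avoiding inversion sequences of rank t.
data Avoider (t : ℕ) : Vec ℕ n → Set where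
  mono : {r : Vec ℕ n} → 1 ≤ m → n ≡ m + suc t → Mono m r → Avoider t r
  zero : Avoider t r → Avoider t (0 ∷ r)
  two  : TwoValued t r → Avoider t (maxEntry r ∷ r)

-- Enumeration of the avoiders

mono-head : {r : Vec ℕ n} → Mono m (x ∷ r) → x ≡ m
mono-head start      = refl
mono-head (stay _)   = refl
mono-head (rise _ _) = refl

mono-prev : {y : ℕ} {r : Vec ℕ n} → Mono m (y ∷ x ∷ r) → x ≤ m
mono-prev (stay M) = ≤-reflexive (mono-head M)
mono-prev (rise M _) = m≤n⇒m≤1+n (mono-prev M)

mono-< : {r : Vec ℕ n} → Mono m r → m < n
mono-< start      = z<s
mono-< (stay M)   = m≤n⇒m≤1+n (mono-< M)
mono-< (rise _ p) = s≤s p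

-- `rise` alters the head only, so undoing the rises leads back to a `stay`, whose premise concerns
-- the tail.
mono-tail : {y : ℕ} {r : Vec ℕ n} → Mono m (y ∷ x ∷ r) → Mono x (x ∷ r)
mono-tail (stay M) with refl ← mono-head M = M
mono-tail (rise M _) = mono-tail M

mono-0 : {r : Vec ℕ n} → Mono 0 r → r ≡ replicate n 0
mono-0 start    = refl
mono-0 (stay M) = cong (0 ∷_) (mono-0 M)

mono-replicate : ∀ n → Mono 0 (replicate (suc n) 0)
mono-replicate zero    = start
mono-replicate (suc n) = stay (mono-replicate n)

-- Ballot numbers, with `t` as the slack between the last entry `m` and its bound `m + t`. Lowering
-- a raised last entry by one increases the slack; deleting a repeated one decreases it, which
-- requires positive slack.
ballot : ℕ → ℕ → ℕ
ballot t       zero    = 1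
ballot zero    (suc m) = ballot 1 m
ballot (suc t) (suc m) = ballot (suc (suc t)) m + ballot t (suc m)

bump : Vec ℕ n → Vec ℕ n
bump []      = []
bump (x ∷ r) = suc x ∷ r

bump-injective : Injective _≡_ _≡_ (bump {n})
bump-injective {x = []}    {[]}    _    = refl
bump-injective {x = _ ∷ _} {_ ∷ _} refl = refl

Rise : ℕ → Vec ℕ n → Set
Rise m = Image bump (Mono m)

Stay : ℕ → Vec ℕ (suc n) → Set
Stay m = Image (m ∷_) (Mono m)

rise-mono : {r : Vec ℕ n} → suc m < n → Rise m r → Mono (suc m) r
rise-mono (s≤s m<n) (_ ∷ _ , M , refl) with refl ← mono-head M = rise M m<n

mono-split : {r : Vec ℕ (suc n)} → Mono (suc m) r → Rise m r ⊎ Stay (suc m) r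
mono-split (stay M)   = inj₂ (_ , M , refl)
mono-split (rise M _) = inj₁ (_ , M , refl)

-- After a bump the head exceeds its neighbour, whereas in `Stay` the two are equal.
rise-stay-disjoint : (r : Vec ℕ (suc n)) → Rise m r → ¬ Stay (suc m) r
rise-stay-disjoint _ (_ ∷ _ ∷ _ , M , refl) (_ , M′ , refl) =
  1+n≰n (≤-trans (≤-reflexive (sym (mono-head M′))) (mono-prev M))

mono-cardinality : ∀ t m n → n ≡ suc (m + t) → HasCardinality (Mono {n} m) (ballot t m)
mono-cardinality t zero _ refl =
  cardinality-singleton _ (mono-replicate t) (λ _ → mono-0)
mono-cardinality zero (suc m) n refl =
  cardinality-⇔ (λ _ → mk⇔ (rise-mono (s≤s (s≤s (m≤m+n m 0)))) split)
    (cardinality-image bump-injective (mono-cardinality 1 m n (cong suc (sym (+-suc m 0)))))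
  where
  split : {r : Vec ℕ n} → Mono (suc m) r → Rise m r
  split M with mono-split M
  ... | inj₁ R            = R
  -- Without slack, removing a repeated last entry would leave length `suc m`, too short for an
  -- inversion sequence ending in `suc m`.
  ... | inj₂ (_ , M′ , _) = ⊥-elim (<-irrefl (sym (+-identityʳ (suc m))) (mono-< M′))
mono-cardinality (suc t) (suc m) n refl =
  cardinality-⇔ (λ _ → mk⇔ join mono-split)
    (cardinality-⊎ rise-stay-disjoint
      (cardinality-image bump-injective
        (mono-cardinality (suc (suc t)) m n (cong suc (sym (+-suc m (suc t))))))
      (cardinality-image ∷-injectiveʳ (mono-cardinality t (suc m) _ (cong suc (+-suc m t)))))
  where
  join : {r : Vec ℕ n} → Rise m r ⊎ Stay (suc m) r → Mono (suc m) r
  join (inj₁ R)              = rise-mono (s≤s (s≤s (m≤m+n m (suc t)))) R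
  join (inj₂ (_ , M , refl)) = stay M

block-mono : {r : Vec ℕ n} → Block x r → Mono x r
block-mono (base {x} {n} _ x≤n) = climb x x≤n
  where
  -- `rise` goes up by one, so the jump from 0 to `x` in `base` is made by `x` rises at fixed
  -- length.
  climb : ∀ x → x ≤ n → Mono x (x ∷ replicate n 0)
  climb zero    _ = mono-replicate n
  climb (suc x) p = rise (climb x (<⇒≤ p)) p
block-mono (more b) = stay (block-mono b)

block-positive : {r : Vec ℕ n} → Block x r → 1 ≤ x
block-positive (base p _) = p
block-positive (more b)   = block-positive b

-- A block of given length is determined by its number of copies of `suc x`. This number is at least
-- 1, and at most `suc t` because `base` asks for at least `suc x` zeros.
block-cardinality : ∀ t x n → n ≡ suc (suc x + t) → HasCardinality (Block {n} (suc x)) (suc t)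
block-cardinality zero x _ refl = cardinality-singleton _ (base (s≤s z≤n) (m≤m+n _ 0)) (λ _ → only)
  where
  only : {r : Vec ℕ (suc (suc x + 0))} → Block (suc x) r → r ≡ suc x ∷ replicate (suc x + 0) 0
  only (base _ _) = refl
  only (more b)   = ⊥-elim (<-irrefl (sym (+-identityʳ (suc x))) (mono-< (block-mono b)))
block-cardinality (suc t) x n refl =
  cardinality-⇔ (λ _ → mk⇔ join split)
    (cardinality-⊎ disjoint
      (cardinality-singleton shortest refl (λ _ eq → eq))
      (cardinality-image ∷-injectiveʳ (block-cardinality t x _ (cong suc (+-suc x t)))))
  where
  shortest : Vec ℕ n
  shortest = suc x ∷ replicate _ 0
  Longer : Vec ℕ n → Set
  Longer = Image (suc x ∷_) (Block (suc x))
  join : {r : Vec ℕ n} → r ≡ shortest ⊎ Longer r → Block (suc x) r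
  join (inj₁ refl)           = base (s≤s z≤n) (m≤m+n _ (suc t))
  join (inj₂ (_ , b , refl)) = more b
  split : {r : Vec ℕ n} → Block (suc x) r → r ≡ shortest ⊎ Longer r
  split (base _ _) = inj₁ refl
  split (more b)   = inj₂ (_ , b , refl)
  disjoint : (r : Vec ℕ n) → r ≡ shortest → ¬ Longer r
  disjoint _ refl (_ , b , refl) with () ← mono-head (block-mono b)

two-positive : {r : Vec ℕ n} → TwoValued t r → 1 ≤ maxEntry r
two-positive (drop {r = _ ∷ r} _ b) with refl ← mono-head (block-mono b) =
  ≤-trans (block-positive b) (m≤m⊔n _ (maxEntry r))
two-positive (zero T) = two-positive T
two-positive (peak T) = ≤-trans (two-positive T) (m≤m⊔n _ _)

-- `drop` puts a 0 after a positive entry, and this descent survives all later extensions, since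
-- prefixes of a weakly increasing sequence increase weakly too.
two-¬mono : {r : Vec ℕ n} → TwoValued t r → ¬ Mono m r
two-¬mono-∷ : {r : Vec ℕ n} → TwoValued t r → ¬ Mono m (x ∷ r)
two-¬mono {r = _ ∷ _ ∷ _} (drop _ b) M with refl ← mono-head M | refl ← mono-head (block-mono b) =
  1+n≰n (≤-trans (block-positive b) (mono-prev M))
two-¬mono (zero T) M = two-¬mono-∷ T M
two-¬mono (peak T) M = two-¬mono-∷ T M
two-¬mono-∷ {r = _ ∷ _} T M = two-¬mono T (mono-tail M)

two-length : {r : Vec ℕ n} → TwoValued t r → 3 + t ≤ n
two-length {t = t} (drop refl b) = s≤s (+-monoˡ-≤ (suc t) (block-positive b))
two-length (zero T) = m≤n⇒m≤1+n (two-length T)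
two-length (peak T) = m≤n⇒m≤1+n (two-length T)

avoider-length : {r : Vec ℕ n} → Avoider t r → 2 + t ≤ n
avoider-length {t = t} (mono 1≤m refl _) = +-monoˡ-≤ (suc t) 1≤m
avoider-length (zero G) = m≤n⇒m≤1+n (avoider-length G)
avoider-length (two T)  = <⇒≤ (m≤n⇒m≤1+n (two-length T))

-- Here `s` is the length minus `suc (suc t)`. The last letter is either the 0 that closes one of
-- `suc t` blocks, or one of the two letters 0 and x after a shorter word of the same kind.
two-count : ℕ → ℕ → ℕ
two-count t zero    = 0
two-count t (suc s) = suc t + (two-count t s + two-count t s)

Zero Peak : (Vec ℕ n → Set) → Vec ℕ (suc n) → Set
Zero = Image (0 ∷_)
Peak = Image (λ r → maxEntry r ∷ r)

zero-peak-disjoint : {P : Vec ℕ n → Set} (r : Vec ℕ (suc n)) → Zero P r → ¬ Peak (TwoValued t) r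
zero-peak-disjoint _ (_ , _ , refl) (q , T , eq) with maxEntry q | two-positive T
zero-peak-disjoint _ (_ , _ , refl) (q , T , ()) | suc _ | _

two-cardinality : ∀ t s n → n ≡ s + suc (suc t) → HasCardinality (TwoValued t {n}) (two-count t s)
two-cardinality t zero    _ refl = cardinality-∅ (λ _ T → 1+n≰n (two-length T))
two-cardinality t (suc s) _ refl =
  cardinality-⇔ (λ _ → mk⇔ join split)
    (cardinality-⊎ disjoint
      (cardinality-image ∷-injectiveʳ (block-cardinality t s N (trans N≡ (cong suc (+-suc s t)))))
      (cardinality-⊎ zero-peak-disjoint
        (cardinality-image ∷-injectiveʳ rec)
        (cardinality-image ∷-injectiveʳ rec)))
  where
  N = s + suc (suc t)
  N≡ : N ≡ suc s + suc t
  N≡ = +-suc s (suc t)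
  rec = two-cardinality t s N refl
  Drop : Vec ℕ (suc N) → Set
  Drop = Zero (Block (suc s))
  join : {r : Vec ℕ (suc N)} → Drop r ⊎ Zero (TwoValued t) r ⊎ Peak (TwoValued t) r → TwoValued t r
  join (inj₁ (_ , b , refl))        = drop N≡ b
  join (inj₂ (inj₁ (_ , T , refl))) = zero T
  join (inj₂ (inj₂ (_ , T , refl))) = peak T
  split : {r : Vec ℕ (suc N)} → TwoValued t r → Drop r ⊎ Zero (TwoValued t) r ⊎ Peak (TwoValued t) r
  split (drop {x = x} eq b)
    with refl ← +-cancelʳ-≡ (suc t) x (suc s) (trans (sym eq) N≡) = inj₁ (_ , b , refl)
  split (zero T) = inj₂ (inj₁ (_ , T , refl))
  split (peak T) = inj₂ (inj₂ (_ , T , refl))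
  disjoint : ∀ r → Drop r → ¬ (Zero (TwoValued t) r ⊎ Peak (TwoValued t) r)
  disjoint _ (_ , b , refl) (inj₁ (_ , T , refl)) = two-¬mono T (block-mono b)
  disjoint _ (_ , b , refl) (inj₂ (_ , T , eq)) with refl ← ∷-injectiveʳ eq = two-¬mono T (block-mono b)

-- Here `s` is the length minus `suc t`, which is also the last entry in the `mono` case.
-- `two-count` measures length from `suc (suc t)`, whence `pred s`; its truncation at 0 does no harm
-- because `two-count t 0` is 0.
avoider-count : ℕ → ℕ → ℕ
avoider-count t zero    = 0
avoider-count t (suc s) = ballot t (suc s) + (avoider-count t s + two-count t (pred s))

avoider-cardinality : ∀ t s n → n ≡ s + suc t → HasCardinality (Avoider t {n}) (avoider-count t s)
avoider-cardinality t zero    _ refl = cardinality-∅ (λ _ G → 1+n≰n (avoider-length G))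
avoider-cardinality t (suc s) _ refl =
  cardinality-⇔ (λ _ → mk⇔ join split)
    (cardinality-⊎ disjoint
      (mono-cardinality t (suc s) _ (cong suc (+-suc s t)))
      (cardinality-⊎ zero-peak-disjoint
        (cardinality-image ∷-injectiveʳ (avoider-cardinality t s _ refl))
        (cardinality-image ∷-injectiveʳ (twos s))))
  where
  N = s + suc t
  twos : ∀ s → HasCardinality (TwoValued t {s + suc t}) (two-count t (pred s))
  twos zero    = cardinality-∅ (λ _ T → 1+n≰n (<⇒≤ (two-length T)))
  twos (suc s) = two-cardinality t s _ (sym (+-suc s (suc t)))
  join : {r : Vec ℕ (suc N)} → Mono (suc s) r ⊎ Zero (Avoider t) r ⊎ Peak (TwoValued t) r → Avoider t r
  join (inj₁ M)                     = mono (s≤s z≤n) refl M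
  join (inj₂ (inj₁ (_ , G , refl))) = zero G
  join (inj₂ (inj₂ (_ , T , refl))) = two T
  split : {r : Vec ℕ (suc N)} → Avoider t r → Mono (suc s) r ⊎ Zero (Avoider t) r ⊎ Peak (TwoValued t) r
  split (mono {m = m} _ eq M) with refl ← +-cancelʳ-≡ (suc t) (suc s) m eq = inj₁ M
  split (zero G) = inj₂ (inj₁ (_ , G , refl))
  split (two T)  = inj₂ (inj₂ (_ , T , refl))
  disjoint : ∀ r → Mono (suc s) r → ¬ (Zero (Avoider t) r ⊎ Peak (TwoValued t) r)
  disjoint _ M (inj₁ (_ , G , refl)) with () ← mono-head M
  disjoint _ M (inj₂ (_ , T , refl)) = two-¬mono-∷ T M

-- Closed forms

pascal : ∀ n k → suc n C suc k ≡ n C k + n C suc k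
pascal n k = sym (nCk+nC[k+1]≡[n+1]C[k+1] n k)

-- Symmetry of an odd row of Pascal's triangle. It makes up for the summand that the recursion of
-- `ballot` lacks at slack 0.
central : ∀ m → (2 * m + 1) C suc m ≡ (2 * m + 1) C m
central m = subst (λ N → N C suc m ≡ N C m) (double m)
  (trans (nCk≡nC[n∸k] (m≤m+n (suc m) m)) (cong ((suc m + m) C_) (m+n∸m≡n (suc m) m)))
  where
  double : ∀ m → suc m + m ≡ 2 * m + 1
  double = solve-∀

-- The reflection principle: a ballot number is a difference of neighbouring binomial coefficients,
-- written here without subtraction. Pascal's rule matches the recursion of `ballot`; at slack 0
-- `central` is used as well.
ballot-difference : ∀ t m → ballot t (suc m) + (2 * suc m + t) C m ≡ (2 * suc m + t) C suc m
ballot-difference zero    zero    = refl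
ballot-difference (suc t) zero    = begin
  suc (ballot t 1) + 1        ≡⟨ cong suc (ballot-difference t 0) ⟩
  suc ((2 + t) C 1)           ≡⟨ pascal (2 + t) 0 ⟨
  (3 + t) C 1                 ∎
  where open ≡-Reasoning
ballot-difference zero    (suc m) = begin
  ballot 1 (suc m) + (2 * suc (suc m) + 0) C suc m ≡⟨ cong (λ N → ballot 1 (suc m) + N C suc m) (shift m) ⟩
  ballot 1 (suc m) + suc N C suc m           ≡⟨ cong₂ _+_ {x = ballot 1 (suc m)} refl (pascal N m) ⟩
  ballot 1 (suc m) + (N C m + N C suc m)     ≡⟨ +-assoc (ballot 1 (suc m)) (N C m) (N C suc m) ⟨
  ballot 1 (suc m) + N C m + N C suc m       ≡⟨ cong (_+ (N C suc m)) (ballot-difference 1 m) ⟩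
  N C suc m + N C suc m                      ≡⟨ cong₂ _+_ {x = N C suc m} refl (central (suc m)) ⟨
  N C suc m + N C suc (suc m)                ≡⟨ pascal N (suc m) ⟨
  suc N C suc (suc m)                        ≡⟨ cong (_C suc (suc m)) (shift m) ⟨
  (2 * suc (suc m) + 0) C suc (suc m)        ∎
  where
  open ≡-Reasoning
  N = 2 * suc m + 1
  shift : ∀ m → 2 * suc (suc m) + 0 ≡ suc (2 * suc m + 1)
  shift = solve-∀
ballot-difference (suc t) (suc m) = begin
  u + v + M C suc m                          ≡⟨ cong (λ M → u + v + M C suc m) (+-suc (2 * suc (suc m)) t) ⟩
  u + v + suc N C suc m                      ≡⟨ cong₂ _+_ {x = u + v} refl (pascal N m) ⟩
  u + v + (N C m + N C suc m)                ≡⟨ exchange u v (N C m) (N C suc m) ⟩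
  (u + N C m) + (v + N C suc m)              ≡⟨ cong₂ _+_ left (ballot-difference t (suc m)) ⟩
  N C suc m + N C suc (suc m)                ≡⟨ pascal N (suc m) ⟨
  suc N C suc (suc m)                        ≡⟨ cong (_C suc (suc m)) (+-suc (2 * suc (suc m)) t) ⟨
  M C suc (suc m)                            ∎
  where
  open ≡-Reasoning
  u = ballot (suc (suc t)) (suc m)
  v = ballot t (suc (suc m))
  M = 2 * suc (suc m) + suc t
  N = 2 * suc (suc m) + t
  exchange : ∀ a b c d → a + b + (c + d) ≡ (a + c) + (b + d)
  exchange = solve-∀
  shift : ∀ m t → 2 * suc m + suc (suc t) ≡ 2 * suc (suc m) + t
  shift = solve-∀
  left : u + N C m ≡ N C suc m
  left = subst (λ N → u + N C m ≡ N C suc m) (shift m t) (ballot-difference (suc (suc t)) m)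

-- The identity (k+1) C(n, k+1) = (n-k) C(n, k), with the negative term moved to the left so that no
-- subtraction is truncated.
absorption : ∀ n k → suc k * (n C suc k) + k * (n C k) ≡ n * (n C k)
absorption zero    zero    = refl
absorption zero    (suc k) = cong₂ _+_ (*-zeroʳ k) (*-zeroʳ k)
absorption (suc n) zero    = begin
  1 * (suc n C 1) + 0 ≡⟨ +-identityʳ _ ⟩
  1 * (suc n C 1)     ≡⟨ *-identityˡ _ ⟩
  suc n C 1           ≡⟨ nC1≡n (suc n) ⟩
  suc n               ≡⟨ *-identityʳ (suc n) ⟨
  suc n * 1           ∎
  where open ≡-Reasoning
absorption (suc n) (suc k) = begin
  suc (suc k) * (suc n C suc (suc k)) + suc k * (suc n C suc k)
    ≡⟨ cong₂ (λ x y → suc (suc k) * x + suc k * y) (pascal n (suc k)) (pascal n k) ⟩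
  suc (suc k) * (b + c) + suc k * (a + b)
    ≡⟨ regroup k a b c ⟩
  (suc (suc k) * c + suc k * b) + (suc k * b + k * a) + (a + b)
    ≡⟨ cong (_+ (a + b)) (cong₂ _+_ (absorption n (suc k)) (absorption n k)) ⟩
  n * b + n * a + (a + b)
    ≡⟨ collect n a b ⟩
  suc n * (a + b)
    ≡⟨ cong (suc n *_) (pascal n k) ⟨
  suc n * (suc n C suc k) ∎
  where
  open ≡-Reasoning
  a = n C k
  b = n C suc k
  c = n C suc (suc k)
  regroup : ∀ k a b c → suc (suc k) * (b + c) + suc k * (a + b) ≡
    (suc (suc k) * c + suc k * b) + (suc k * b + k * a) + (a + b)
  regroup = solve-∀
  collect : ∀ n a b → n * b + n * a + (a + b) ≡ suc n * (a + b)
  collect = solve-∀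

-- Adding `suc (suc m + t) * a` to both sides brings in `ballot-difference`; what remains is the
-- ratio of the neighbouring coefficients `a` and `b`.
ballot-formula : ∀ t m → suc (m + t) * ballot t m ≡ suc t * ((2 * m + t) C m)
ballot-formula t zero    = refl
ballot-formula t (suc m) = +-cancelʳ-≡ (suc (suc m + t) * a) _ _ (begin
  suc (suc m + t) * ballot t (suc m) + suc (suc m + t) * a
    ≡⟨ *-distribˡ-+ (suc (suc m + t)) (ballot t (suc m)) a ⟨
  suc (suc m + t) * (ballot t (suc m) + a)
    ≡⟨ cong (suc (suc m + t) *_) (ballot-difference t m) ⟩
  suc (suc m + t) * b
    ≡⟨ regroup m t b ⟩
  suc t * b + suc m * b
    ≡⟨ cong₂ _+_ {x = suc t * b} refl ratio ⟩
  suc t * b + suc (suc m + t) * a ∎)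
  where
  open ≡-Reasoning
  N = 2 * suc m + t
  a = N C m
  b = N C suc m
  regroup : ∀ m t b → suc (suc m + t) * b ≡ suc t * b + suc m * b
  regroup = solve-∀
  collect : ∀ m t a → (2 * suc m + t) * a ≡ suc (suc m + t) * a + m * a
  collect = solve-∀
  -- `absorption` applies with N - m = m + t + 2.
  ratio : suc m * b ≡ suc (suc m + t) * a
  ratio = +-cancelʳ-≡ (m * a) _ _ (trans (absorption N m) (collect m t a))

-- Adding `suc t` turns the recursion of `two-count` into pure doubling.
two-count-formula : ∀ t s → two-count t s + suc t ≡ suc t * 2 ^ s
two-count-formula t zero    = sym (*-identityʳ (suc t))
two-count-formula t (suc s) = begin
  suc t + (c + c) + suc t     ≡⟨ regroup t c ⟩
  2 * (c + suc t)             ≡⟨ cong (2 *_) (two-count-formula t s) ⟩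
  2 * (suc t * 2 ^ s)         ≡⟨ collect t (2 ^ s) ⟩
  suc t * (2 * 2 ^ s)         ∎
  where
  open ≡-Reasoning
  c = two-count t s
  regroup : ∀ t c → suc t + (c + c) + suc t ≡ 2 * (c + suc t)
  regroup = solve-∀
  collect : ∀ t p → 2 * (suc t * p) ≡ suc t * (2 * p)
  collect = solve-∀

-- Passage to rational numbers

ι : ℕ → ℚ
ι n = fromℤ (+ n)

ι-+ : ∀ m n → ι (m + n) ≡ ι m ℚ.+ ι n
ι-+ m n = ℚ.toℚᵘ-injective (ℚᵘ.≃-trans
  (*≡* (cong (ℤ._* + 1) (sym (cong₂ ℤ._+_ (ℤ.*-identityʳ (+ m)) (ℤ.*-identityʳ (+ n))))))
  (ℚᵘ.≃-sym (ℚ.toℚᵘ-homo-+ (ι m) (ι n))))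

ι-* : ∀ m n → ι (m * n) ≡ ι m ℚ.* ι n
ι-* m n = ℚ.toℚᵘ-injective (ℚᵘ.≃-trans
  (*≡* (cong (ℤ._* + 1) (ℤ.pos-* m n)))
  (ℚᵘ.≃-sym (ℚ.toℚᵘ-homo-* (ι m) (ι n))))

1/-inverse : ∀ k → (+ 1 / suc k) ℚ.* ι (suc k) ≡ 1ℚ
1/-inverse k = ℚ.toℚᵘ-injective (ℚᵘ.≃-trans (ℚ.toℚᵘ-homo-* (+ 1 / suc k) (ι (suc k)))
  (ℚᵘ.≃-trans (ℚᵘ.*-congʳ {toℚᵘ (ι (suc k))} (ℚ.toℚᵘ-fromℚᵘ (mkℚᵘ (+ 1) k)))
    (*≡* (trans (ℤ.*-identityʳ _) (trans (ℤ.*-identityˡ (+ suc k)) (sym (trans (ℤ.*-identityˡ _) (ℤ.*-identityʳ (+ suc k)))))))))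

term : ℕ → ℕ → ℚ
term t m = (+ 1 / suc (m + t)) ℚ.* ι ((2 * m + t) C m)

ballot-term : ∀ t m → ι (suc t) ℚ.* term t m ≡ ι (ballot t m)
ballot-term t m = begin
  T ℚ.* (q ℚ.* c)                    ≡⟨ regroup T q c ⟩
  q ℚ.* (T ℚ.* c)                    ≡⟨ cong (q ℚ.*_) (ι-* (suc t) _) ⟨
  q ℚ.* ι (suc t * ((2 * m + t) C m)) ≡⟨ cong (λ N → q ℚ.* ι N) (ballot-formula t m) ⟨
  q ℚ.* ι (suc (m + t) * ballot t m)  ≡⟨ cong (q ℚ.*_) (ι-* (suc (m + t)) _) ⟩
  q ℚ.* (ι (suc (m + t)) ℚ.* b)       ≡⟨ ℚ.*-assoc q _ b ⟨
  q ℚ.* ι (suc (m + t)) ℚ.* b         ≡⟨ cong (ℚ._* b) (1/-inverse (m + t)) ⟩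
  1ℚ ℚ.* b                            ≡⟨ ℚ.*-identityˡ b ⟩
  b ∎
  where
  open ≡-Reasoning
  open +-*-Solver
  T = ι (suc t)
  q = + 1 / suc (m + t)
  c = ι ((2 * m + t) C m)
  b = ι (ballot t m)
  regroup : ∀ T q c → T ℚ.* (q ℚ.* c) ≡ q ℚ.* (T ℚ.* c)
  regroup = solve 3 (λ T q c → T :* (q :* c) := q :* (T :* c)) refl

-- Each induction step adds a ballot number, which is the next term of the sum times t+1, and
-- (t+1)(2^s - 1), which is exactly what turns 2^s - (s+1) into 2^(s+1) - (s+2).
avoider-count-formula : ∀ t s → ι (avoider-count t (suc s)) ≡
  ι (suc t) ℚ.* (ι (2 ^ s) ℚ.- ι (suc s) ℚ.+ sumFrom1To (suc s) (term t))
avoider-count-formula t zero = begin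
  ι (ballot t 1 + 0)                                    ≡⟨ cong ι (+-identityʳ (ballot t 1)) ⟩
  ι (ballot t 1)                                        ≡⟨ ballot-term t 1 ⟨
  T ℚ.* term t 1                                        ≡⟨ regroup T (ι 1) (term t 1) ⟩
  T ℚ.* (ι 1 ℚ.- ι 1 ℚ.+ (0ℚ ℚ.+ term t 1)) ∎
  where
  open ≡-Reasoning
  open +-*-Solver
  T = ι (suc t)
  regroup : ∀ T a x → T ℚ.* x ≡ T ℚ.* (a ℚ.- a ℚ.+ (0ℚ ℚ.+ x))
  regroup = solve 3 (λ T a x → T :* x := T :* (a :- a :+ (con 0ℚ :+ x))) refl
avoider-count-formula t (suc s) = begin
  ι (ballot t (2 + s) + (g + w))                ≡⟨ ι-+ (ballot t (2 + s)) (g + w) ⟩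
  ι (ballot t (2 + s)) ℚ.+ ι (g + w)            ≡⟨ cong₂ ℚ._+_ (sym (ballot-term t (2 + s))) (ι-+ g w) ⟩
  T ℚ.* z ℚ.+ (ι g ℚ.+ ι w)                     ≡⟨ cong₂ (λ a b → T ℚ.* z ℚ.+ (a ℚ.+ b)) (avoider-count-formula t s) twos ⟩
  T ℚ.* z ℚ.+ (T ℚ.* (p ℚ.- ι (suc s) ℚ.+ Σ) ℚ.+ (T ℚ.* p ℚ.- T))
                                                ≡⟨ regroup T z p (ι (suc s)) Σ ⟩
  T ℚ.* (p ℚ.+ p ℚ.- (1ℚ ℚ.+ ι (suc s)) ℚ.+ (Σ ℚ.+ z))
    ≡⟨ cong₂ (λ a b → T ℚ.* (a ℚ.- b ℚ.+ (Σ ℚ.+ z))) double (sym (ι-+ 1 (suc s))) ⟩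
  T ℚ.* (ι (2 ^ suc s) ℚ.- ι (2 + s) ℚ.+ (Σ ℚ.+ z)) ∎
  where
  open ≡-Reasoning
  open +-*-Solver
  T = ι (suc t)
  g = avoider-count t (suc s)
  w = two-count t s
  z = term t (2 + s)
  p = ι (2 ^ s)
  Σ = sumFrom1To (suc s) (term t)
  double : p ℚ.+ p ≡ ι (2 ^ suc s)
  double = trans (sym (ι-+ (2 ^ s) (2 ^ s))) (cong (λ k → ι (2 ^ s + k)) (sym (+-identityʳ (2 ^ s))))
  cancel : ∀ a b → a ≡ a ℚ.+ b ℚ.- b
  cancel = solve 2 (λ a b → a := a :+ b :- b) refl
  twos : ι w ≡ T ℚ.* p ℚ.- T
  twos = trans (cancel (ι w) T) (cong (ℚ._- T)
    (trans (sym (ι-+ w (suc t))) (trans (cong ι (two-count-formula t s)) (ι-* (suc t) (2 ^ s)))))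
  regroup : ∀ T x p s Σ → T ℚ.* x ℚ.+ (T ℚ.* (p ℚ.- s ℚ.+ Σ) ℚ.+ (T ℚ.* p ℚ.- T)) ≡
    T ℚ.* (p ℚ.+ p ℚ.- (1ℚ ℚ.+ s) ℚ.+ (Σ ℚ.+ x))
  regroup = solve 5 (λ T x p s Σ → T :* x :+ (T :* (p :- s :+ Σ) :+ (T :* p :- T)) :=
    T :* (p :+ p :- (con 1ℚ :+ s) :+ (Σ :+ x))) refl

-- Pattern avoidance and reversal

lookup-∷ʳ-inject₁ : (v : Vec A n) (x : A) (i : Fin n) → lookup (v ∷ʳ x) (inject₁ i) ≡ lookup v i
lookup-∷ʳ-inject₁ (_ ∷ _) x zero    = refl
lookup-∷ʳ-inject₁ (_ ∷ v) x (suc i) = lookup-∷ʳ-inject₁ v x i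

lookup-∷ʳ-fromℕ : (v : Vec A n) (x : A) → lookup (v ∷ʳ x) (fromℕ n) ≡ x
lookup-∷ʳ-fromℕ []      x = refl
lookup-∷ʳ-fromℕ (_ ∷ v) x = lookup-∷ʳ-fromℕ v x

lookup-reverse-opposite : (v : Vec A n) (i : Fin n) → lookup (reverse v) (opposite i) ≡ lookup v i
lookup-reverse-opposite {n = suc n} (x ∷ v) zero =
  trans (cong (λ w → lookup w (fromℕ n)) (reverse-∷ x v)) (lookup-∷ʳ-fromℕ (reverse v) x)
lookup-reverse-opposite (x ∷ v) (suc i) =
  trans (cong (λ w → lookup w (inject₁ (opposite i))) (reverse-∷ x v))
    (trans (lookup-∷ʳ-inject₁ (reverse v) x (opposite i)) (lookup-reverse-opposite v i))

lookup-reverse : (v : Vec A n) (i : Fin n) → lookup (reverse v) i ≡ lookup v (opposite i)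
lookup-reverse v i =
  trans (cong (lookup (reverse v)) (sym (opposite-involutive i))) (lookup-reverse-opposite v (opposite i))

opposite-< : {i j : Fin n} → i Fin.< j → opposite j Fin.< opposite i
opposite-< {n} {i} {j} i<j = subst₂ _<_ (sym (opposite-prop j)) (sym (opposite-prop i))
  (∸-monoʳ-< (s<s i<j) (toℕ<n j))

ReverseInversion : Vec ℕ n → Set
ReverseInversion r = ∀ i → lookup r i ≤ toℕ (opposite i)

-- In a reversal the first, second and third letter of a pattern are found at the
-- indices k > j > i.
data Has102 (r : Vec ℕ n) : Set where
  has : ∀ {i j k} → i Fin.< j → j Fin.< k →
    lookup r j < lookup r k → lookup r k < lookup r i → Has102 r

data Has021 (r : Vec ℕ n) : Set where
  has : ∀ {i j k} → i Fin.< j → j Fin.< k →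
    lookup r k < lookup r i → lookup r i < lookup r j → Has021 r

Valid : Vec ℕ n → Set
Valid r = ReverseInversion r × ¬ Has102 r × ¬ Has021 r

SameOrder : ℕ → ℕ → ℕ → ℕ → Set
SameOrder a b x y = (a < b ⇔ x < y) × (a ≡ b ⇔ x ≡ y)

both-< : ∀ {a b x y} → a < b → x < y → SameOrder a b x y
both-< p q = mk⇔ (λ _ → q) (λ _ → p)
  , mk⇔ (λ e → ⊥-elim (<⇒≢ p e)) (λ e → ⊥-elim (<⇒≢ q e))

both-> : ∀ {a b x y} → b < a → y < x → SameOrder a b x y
both-> p q = mk⇔ (λ r → ⊥-elim (<-asym p r)) (λ r → ⊥-elim (<-asym q r))
  , mk⇔ (λ e → ⊥-elim (<⇒≢ p (sym e))) (λ e → ⊥-elim (<⇒≢ q (sym e)))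

both-≡ : ∀ {a x} → SameOrder a a x x
both-≡ = mk⇔ (λ p → ⊥-elim (<-irrefl refl p)) (λ p → ⊥-elim (<-irrefl refl p))
  , mk⇔ (λ _ → refl) (λ _ → refl)

iso-102 : ∀ {a b c} → b < a → a < c → OrderIsomorphic (a ∷ b ∷ c ∷ []) (1 ∷ 0 ∷ 2 ∷ [])
iso-102 b<a a<c zero             zero             = both-≡
iso-102 b<a a<c zero             (suc zero)       = both-> b<a z<s
iso-102 b<a a<c zero             (suc (suc zero)) = both-< a<c (s<s z<s)
iso-102 b<a a<c (suc zero)       zero             = both-< b<a z<s
iso-102 b<a a<c (suc zero)       (suc zero)       = both-≡
iso-102 b<a a<c (suc zero)       (suc (suc zero)) = both-< (<-trans b<a a<c) z<s
iso-102 b<a a<c (suc (suc zero)) zero             = both-> a<c (s<s z<s)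
iso-102 b<a a<c (suc (suc zero)) (suc zero)       = both-> (<-trans b<a a<c) z<s
iso-102 b<a a<c (suc (suc zero)) (suc (suc zero)) = both-≡

iso-021 : ∀ {a b c} → a < c → c < b → OrderIsomorphic (a ∷ b ∷ c ∷ []) (0 ∷ 2 ∷ 1 ∷ [])
iso-021 a<c c<b zero             zero             = both-≡
iso-021 a<c c<b zero             (suc zero)       = both-< (<-trans a<c c<b) z<s
iso-021 a<c c<b zero             (suc (suc zero)) = both-< a<c z<s
iso-021 a<c c<b (suc zero)       zero             = both-> (<-trans a<c c<b) z<s
iso-021 a<c c<b (suc zero)       (suc zero)       = both-≡
iso-021 a<c c<b (suc zero)       (suc (suc zero)) = both-> c<b (s<s z<s)
iso-021 a<c c<b (suc (suc zero)) zero             = both-> a<c z<s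
iso-021 a<c c<b (suc (suc zero)) (suc zero)       = both-< c<b (s<s z<s)
iso-021 a<c c<b (suc (suc zero)) (suc (suc zero)) = both-≡

module _ (r : Vec ℕ n) where

  private
    <-to : ∀ {i j} → lookup (reverse r) i < lookup (reverse r) j → lookup r (opposite i) < lookup r (opposite j)
    <-to {i} {j} = subst₂ _<_ (lookup-reverse r i) (lookup-reverse r j)
    <-from : ∀ {i j} → lookup r i < lookup r j → lookup (reverse r) (opposite i) < lookup (reverse r) (opposite j)
    <-from {i} {j} = subst₂ _<_ (sym (lookup-reverse-opposite r i)) (sym (lookup-reverse-opposite r j))

  -- Two comparisons fix the order of the three letters, so only these are read off; `iso-102`
  -- recovers all the others.
  contains-102 : Contains (reverse r) (1 ∷ 0 ∷ 2 ∷ []) ⇔ Has102 r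
  contains-102 = mk⇔
    (λ (_ , _ , _ , i<j , j<k , iso) → has (opposite-< j<k) (opposite-< i<j)
      (<-to (from (proj₁ (iso (suc zero) zero)) z<s))
      (<-to (from (proj₁ (iso zero (suc (suc zero)))) (s<s z<s))))
    (λ { (has i<j j<k p q) → _ , _ , _ , opposite-< j<k , opposite-< i<j , iso-102 (<-from p) (<-from q) })

  contains-021 : Contains (reverse r) (0 ∷ 2 ∷ 1 ∷ []) ⇔ Has021 r
  contains-021 = mk⇔
    (λ (_ , _ , _ , i<j , j<k , iso) → has (opposite-< j<k) (opposite-< i<j)
      (<-to (from (proj₁ (iso zero (suc (suc zero)))) z<s))
      (<-to (from (proj₁ (iso (suc (suc zero)) (suc zero))) (s<s z<s))))
    (λ { (has i<j j<k p q) → _ , _ , _ , opposite-< j<k , opposite-< i<j , iso-021 (<-from p) (<-from q) })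

  inversion-reverse : IsInversionSequence (reverse r) ⇔ ReverseInversion r
  inversion-reverse = mk⇔
    (λ inv i → subst (_≤ toℕ (opposite i)) (lookup-reverse-opposite r i) (inv (opposite i)))
    (λ inv i → subst₂ _≤_ (sym (lookup-reverse r i)) (cong toℕ (opposite-involutive i)) (inv (opposite i)))

-- Maxima

max-upper : (r : Vec ℕ n) (i : Fin n) → lookup r i ≤ maxEntry r
max-upper (x ∷ r) zero    = m≤m⊔n x (maxEntry r)
max-upper (x ∷ r) (suc i) = ≤-trans (max-upper r i) (m≤n⊔m x (maxEntry r))

max-least : (r : Vec ℕ n) → (∀ i → lookup r i ≤ m) → maxEntry r ≤ m
max-least []      _ = z≤n
max-least (x ∷ r) p = ⊔-lub (p zero) (max-least r (λ i → p (suc i)))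

max-attained : (r : Vec ℕ (suc n)) → ∃[ i ] lookup r i ≡ maxEntry r
max-attained (x ∷ []) = zero , sym (⊔-identityʳ x)
max-attained (x ∷ r@(_ ∷ _)) with ⊔-sel x (maxEntry r) | max-attained r
... | inj₁ eq | _      = zero , sym eq
... | inj₂ eq | i , eq′ = suc i , trans eq′ (sym eq)

max-∷ʳ : (v : Vec ℕ n) (x : ℕ) → maxEntry (v ∷ʳ x) ≡ x ⊔ maxEntry v
max-∷ʳ []      x = refl
max-∷ʳ (y ∷ v) x = begin
  y ⊔ maxEntry (v ∷ʳ x)  ≡⟨ cong (y ⊔_) (max-∷ʳ v x) ⟩
  y ⊔ (x ⊔ maxEntry v)   ≡⟨ ⊔-assoc y x _ ⟨
  y ⊔ x ⊔ maxEntry v     ≡⟨ cong (_⊔ maxEntry v) (⊔-comm y x) ⟩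
  x ⊔ y ⊔ maxEntry v     ≡⟨ ⊔-assoc x y _ ⟩
  x ⊔ (y ⊔ maxEntry v)   ∎
  where open ≡-Reasoning

max-reverse : (r : Vec ℕ n) → maxEntry (reverse r) ≡ maxEntry r
max-reverse []      = refl
max-reverse (x ∷ r) =
  trans (cong maxEntry (reverse-∷ x r)) (trans (max-∷ʳ (reverse r) x) (cong (x ⊔_) (max-reverse r)))

-- Validity of the generated sequences

mono-bound : {r : Vec ℕ n} → Mono m r → ∀ i → lookup r i ≤ m
mono-bound start      zero    = z≤n
mono-bound (stay M)   zero    = ≤-refl
mono-bound (stay M)   (suc i) = mono-bound M i
mono-bound (rise M _) zero    = ≤-refl
mono-bound (rise M _) (suc i) = m≤n⇒m≤1+n (mono-bound M (suc i))

mono-sorted : {r : Vec ℕ n} → Mono m r → ∀ {i j} → i Fin.< j → lookup r j ≤ lookup r i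
mono-sorted M {zero}  {suc j} _ with M
... | stay M′   = mono-bound M′ j
... | rise M′ _ = m≤n⇒m≤1+n (mono-bound M′ (suc j))
mono-sorted {r = _ ∷ _ ∷ _} M {suc i} {suc j} i<j = mono-sorted (mono-tail M) (s<s⁻¹ i<j)

mono-max : {r : Vec ℕ n} → Mono m r → maxEntry r ≡ m
mono-max {r = x ∷ r} M with refl ← mono-head M =
  ≤-antisym (max-least (x ∷ r) (mono-bound M)) (m≤m⊔n x (maxEntry r))

inversion-∷ : {r : Vec ℕ n} → x ≤ n → ReverseInversion r → ReverseInversion (x ∷ r)
inversion-∷ {n = n} x≤n inv zero    = ≤-trans x≤n (≤-reflexive (sym (toℕ-fromℕ n)))
inversion-∷ x≤n inv (suc i) = ≤-trans (inv i) (≤-reflexive (sym (toℕ-inject₁ (opposite i))))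

-- The new entry stands at the right end of the sequence, so a new pattern can use it only as its
-- third letter.
valid-∷ : {r : Vec ℕ n} → x ≤ n →
  (∀ {i j} → i Fin.< j → lookup r i < lookup r j → ¬ lookup r j < x) →
  (∀ {i j} → i Fin.< j → lookup r j < x → ¬ x < lookup r i) →
  Valid r → Valid (x ∷ r)
valid-∷ {x = x} {r = r} x≤n no102 no021 (inv , ¬102 , ¬021) = inversion-∷ x≤n inv , ¬102′ , ¬021′
  where
  ¬102′ : ¬ Has102 (x ∷ r)
  ¬102′ (has {zero}  {suc j} {suc k} _ j<k p q)   = no102 (s<s⁻¹ j<k) p q
  ¬102′ (has {suc i} {suc j} {suc k} i<j j<k p q) = ¬102 (has (s<s⁻¹ i<j) (s<s⁻¹ j<k) p q)
  ¬021′ : ¬ Has021 (x ∷ r)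
  ¬021′ (has {zero}  {suc j} {suc k} _ j<k p q)   = no021 (s<s⁻¹ j<k) p q
  ¬021′ (has {suc i} {suc j} {suc k} i<j j<k p q) = ¬021 (has (s<s⁻¹ i<j) (s<s⁻¹ j<k) p q)

valid-tail : {r : Vec ℕ n} → Valid (x ∷ r) → Valid r
valid-tail (inv , ¬102 , ¬021) =
  (λ i → ≤-trans (inv (suc i)) (≤-reflexive (toℕ-inject₁ (opposite i))))
  , (λ { (has i<j j<k p q) → ¬102 (has (s<s i<j) (s<s j<k) p q) })
  , (λ { (has i<j j<k p q) → ¬021 (has (s<s i<j) (s<s j<k) p q) })

valid-0∷ : {r : Vec ℕ n} → Valid r → Valid (0 ∷ r)
valid-0∷ = valid-∷ z≤n (λ _ _ ()) (λ _ ())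

mono-inversion : {r : Vec ℕ n} → Mono m r → ReverseInversion r
mono-inversion start zero = z≤n
mono-inversion {r = _ ∷ []}    (stay ()) 
mono-inversion {r = x ∷ _ ∷ _} M =
  inversion-∷ (≤-trans (≤-reflexive (mono-head M)) (s≤s⁻¹ (mono-< M))) (mono-inversion (mono-tail M))
mono-inversion {r = _ ∷ []}    (rise M ()) 

mono-valid : {r : Vec ℕ n} → Mono m r → Valid r
mono-valid M = mono-inversion M
  , (λ { (has i<j j<k p q) → <⇒≱ p (mono-sorted M j<k) })
  , (λ { (has i<j j<k p q) → <⇒≱ q (mono-sorted M i<j) })

block-entries : {r : Vec ℕ n} → Block x r → ∀ i → lookup r i ≡ 0 ⊎ lookup r i ≡ x
block-entries (base _ _) zero            = inj₂ refl
block-entries (base _ _) (suc i) = inj₁ (lookup-replicate i 0)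
block-entries (more b)   zero            = inj₂ refl
block-entries (more b)   (suc i)         = block-entries b i

two-entries : {r : Vec ℕ n} → TwoValued t r → ∀ i → lookup r i ≡ 0 ⊎ lookup r i ≡ maxEntry r
two-entries (drop _ b) zero    = inj₁ refl
two-entries (drop _ b) (suc i) = Sum.map₂ (λ eq → trans eq (sym (mono-max (block-mono b)))) (block-entries b i)
two-entries (zero T)   zero    = inj₁ refl
two-entries (zero T)   (suc i) = two-entries T i
two-entries (peak T)   zero    = inj₂ (sym (⊔-idem _))
two-entries (peak T)   (suc i) = Sum.map₂ (λ eq → trans eq (sym (⊔-idem _))) (two-entries T i)

inversion-max : (r : Vec ℕ n) → ReverseInversion r → maxEntry r ≤ n
inversion-max r inv = max-least r (λ i → ≤-trans (inv i) (<⇒≤ (toℕ<n (opposite i))))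

-- A new 102 would need two distinct values below the maximum, but only 0 and the maximum occur; a
-- new 021 would need an entry above the maximum.
peak-valid : {r : Vec ℕ n} → TwoValued t r → Valid r → Valid (maxEntry r ∷ r)
peak-valid {r = r} T V = valid-∷ (inversion-max r (proj₁ V)) no102 (λ {i} _ _ q → <⇒≱ q (max-upper r i)) V
  where
  no102 : ∀ {i j} → i Fin.< j → lookup r i < lookup r j → ¬ lookup r j < maxEntry r
  no102 {j = j} _ p q with two-entries T j
  ... | inj₁ eq = n≮0 (subst (_ <_) eq p)
  ... | inj₂ eq = <-irrefl eq q

two-valid : {r : Vec ℕ n} → TwoValued t r → Valid r
two-valid (drop _ b) = valid-0∷ (mono-valid (block-mono b))
two-valid (zero T)   = valid-0∷ (two-valid T)
two-valid (peak T)   = peak-valid T (two-valid T)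

avoider-valid : {r : Vec ℕ n} → Avoider t r → Valid r
avoider-valid (mono _ _ M) = mono-valid M
avoider-valid (zero G)     = valid-0∷ (avoider-valid G)
avoider-valid (two T)      = peak-valid T (two-valid T)

two-avoider : {r : Vec ℕ n} → TwoValued t r → Avoider t r
two-avoider (drop eq b) = zero (mono (block-positive b) eq (block-mono b))
two-avoider (zero T)    = zero (two-avoider T)
two-avoider (peak T)    = two T

-- First descents

≤ᵇ-true : m ≤ n → (m ≤ᵇ n) ≡ true
≤ᵇ-true {m} {n} m≤n with m ≤ᵇ n | ≤⇒≤ᵇ m≤n
... | true | _ = refl

≤ᵇ-false : n < m → (m ≤ᵇ n) ≡ false
≤ᵇ-false {n} {m} n<m with m ≤ᵇ n in eq
... | false = refl
... | true  = ⊥-elim (<⇒≱ n<m (≤ᵇ⇒≤ m n (subst Bool.T (sym eq) _)))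

-- By the convention at the end, `fdes v` equals the length exactly when `v` increases weakly.
-- Otherwise the first descent is a genuine one, and a further entry cannot move it.
fdes-∷ʳ-early : (v : Vec ℕ n) (x : ℕ) → fdes v ≢ n → fdes (v ∷ʳ x) ≡ fdes v
fdes-∷ʳ-early []          x ≢n = ⊥-elim (≢n refl)
fdes-∷ʳ-early (_ ∷ [])    x ≢n = ⊥-elim (≢n refl)
fdes-∷ʳ-early (a ∷ b ∷ v) x ≢n with a ≤ᵇ b | fdes-∷ʳ-early (b ∷ v) x
... | true  | ih = cong suc (ih (λ eq → ≢n (cong suc eq)))
... | false | _  = refl

fdes-∷ʳ-≤ : (v : Vec ℕ n) → fdes (v ∷ʳ y) ≡ suc n → y ≤ x → fdes (v ∷ʳ y ∷ʳ x) ≡ 2 + n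
fdes-∷ʳ-≤ [] _ y≤x rewrite ≤ᵇ-true y≤x = refl
fdes-∷ʳ-≤ {y = y} {x} (a ∷ []) eq y≤x with a ≤ᵇ y
... | true rewrite ≤ᵇ-true y≤x = refl
fdes-∷ʳ-≤ {y = y} {x} (a ∷ b ∷ v) eq y≤x with a ≤ᵇ b | fdes-∷ʳ-≤ {y = y} {x} (b ∷ v)
... | true | ih = cong suc (ih (suc-injective eq) y≤x)

fdes-∷ʳ-> : (v : Vec ℕ n) → fdes (v ∷ʳ y) ≡ suc n → x < y → fdes (v ∷ʳ y ∷ʳ x) ≡ suc n
fdes-∷ʳ-> [] _ x<y rewrite ≤ᵇ-false x<y = refl
fdes-∷ʳ-> {y = y} {x} (a ∷ []) eq x<y with a ≤ᵇ y
... | true rewrite ≤ᵇ-false x<y = refl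
fdes-∷ʳ-> {y = y} {x} (a ∷ b ∷ v) eq x<y with a ≤ᵇ b | fdes-∷ʳ-> {y = y} {x} (b ∷ v)
... | true | ih = cong suc (ih (suc-injective eq) x<y)

reverse-∷∷ : (r : Vec A n) (x y : A) → reverse (x ∷ y ∷ r) ≡ reverse r ∷ʳ y ∷ʳ x
reverse-∷∷ r x y = trans (reverse-∷ x (y ∷ r)) (cong (_∷ʳ x) (reverse-∷ y r))

-- The strict bound records a genuine descent and is carried along so that the lemma can be
-- iterated.
fdes-reverse-early : (r : Vec ℕ n) (x : ℕ) → fdes (reverse r) < n × fdes (reverse r) ≡ k →
  fdes (reverse (x ∷ r)) < suc n × fdes (reverse (x ∷ r)) ≡ k
fdes-reverse-early {n} r x (p , eq) =
  subst (_< suc n) (sym step) (m≤n⇒m≤1+n p) , trans step eq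
  where
  step : fdes (reverse (x ∷ r)) ≡ fdes (reverse r)
  step = trans (cong fdes (reverse-∷ x r)) (fdes-∷ʳ-early (reverse r) x (<⇒≢ p))

mono-fdes : (r : Vec ℕ n) → Mono m r → fdes (reverse r) ≡ n
mono-fdes (x ∷ [])    _ = refl
mono-fdes (x ∷ y ∷ r) M = trans (cong fdes (reverse-∷∷ r x y))
  (fdes-∷ʳ-≤ (reverse r)
    (trans (cong fdes (sym (reverse-∷ y r))) (mono-fdes (y ∷ r) (mono-tail M)))
    (≤-trans (mono-prev M) (≤-reflexive (sym (mono-head M)))))

mono-rank : {r : Vec ℕ n} → n ≡ m + suc t → Mono m r → fdes (reverse r) ≡ maxEntry r + suc t
mono-rank {t = t} {r = r} refl M = trans (mono-fdes r M) (cong (_+ suc t) (sym (mono-max M)))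

mono-fdes-0∷ : {r : Vec ℕ n} → 1 ≤ m → n ≡ m + suc t → Mono m r →
  fdes (reverse (0 ∷ r)) < suc n × fdes (reverse (0 ∷ r)) ≡ maxEntry r + suc t
mono-fdes-0∷ {r = y ∷ r} 1≤m eq M =
  ≤-reflexive (cong suc step) , trans step (trans (sym full) (mono-rank eq M))
  where
  full = mono-fdes (y ∷ r) M
  step = trans (cong fdes (reverse-∷∷ r 0 y))
    (fdes-∷ʳ-> (reverse r) (trans (cong fdes (sym (reverse-∷ y r))) full)
      (≤-trans 1≤m (≤-reflexive (sym (mono-head M)))))

two-fdes : {r : Vec ℕ n} → TwoValued t r → fdes (reverse r) < n × fdes (reverse r) ≡ maxEntry r + suc t
two-fdes (drop eq b) = mono-fdes-0∷ (block-positive b) eq (block-mono b)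
two-fdes (zero {r = r} T) = fdes-reverse-early r 0 (two-fdes T)
two-fdes {t = t} (peak {r = r} T) = fdes-reverse-early r (maxEntry r)
  (p , trans eq (cong (_+ suc t) (sym (⊔-idem (maxEntry r)))))
  where
  p = proj₁ (two-fdes T)
  eq = proj₂ (two-fdes T)

-- An avoider may still be weakly increasing, but a final 0 forces a genuine descent; hence the
-- induction runs over `0 ∷ r`.
avoider-fdes-0∷ : {r : Vec ℕ n} → Avoider t r →
  fdes (reverse (0 ∷ r)) < suc n × fdes (reverse (0 ∷ r)) ≡ maxEntry r + suc t
avoider-fdes-0∷ (mono p eq M)    = mono-fdes-0∷ p eq M
avoider-fdes-0∷ (zero {r = r} G) = fdes-reverse-early (0 ∷ r) 0 (avoider-fdes-0∷ G)
avoider-fdes-0∷ (two {r = r} T)  = fdes-reverse-early (maxEntry r ∷ r) 0 (two-fdes (peak T))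

avoider-fdes : {r : Vec ℕ n} → Avoider t r → fdes (reverse r) ≡ maxEntry r + suc t
avoider-fdes (mono _ eq M) = mono-rank eq M
avoider-fdes (zero G)      = proj₂ (avoider-fdes-0∷ G)
avoider-fdes (two T)       = proj₂ (two-fdes (peak T))

-- Classification of avoiding sequences

-- A refinement of `Avoider` that remembers which entries may follow. In `fall`, an entry below the
-- maximum has been followed by a smaller one, and from then on only 0 is possible.
data Shape (r : Vec ℕ n) : Set where
  mono : Mono m r → Shape r
  two  : TwoValued t r → Shape r
  fall : ∀ {i j} → Avoider t r → i Fin.< j → lookup r i < lookup r j → lookup r j < maxEntry r → Shape r

mono-extend : {r : Vec ℕ n} → Mono m r → m ≤ x → x ≤ n → Mono x (x ∷ r)
mono-extend {x = zero}  M z≤n _ = stay M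
mono-extend {x = suc x} M m≤x x≤n with m≤n⇒m<n∨m≡n m≤x
... | inj₁ m<1+x = rise (mono-extend M (s≤s⁻¹ m<1+x) (<⇒≤ x≤n)) x≤n
... | inj₂ refl  = stay M

-- This decides what a subsequent 0 produces: a block becomes `TwoValued`, while an entry strictly
-- between 0 and `m` leads to `fall`.
mono-cases : {r : Vec ℕ n} → Mono m r →
  m ≡ 0 ⊎ Block m r ⊎ ∃[ i ] 0 < lookup r i × lookup r i < m
mono-cases start = inj₁ refl
mono-cases (stay M) with mono-cases M
... | inj₁ eq                   = inj₁ eq
... | inj₂ (inj₁ b)             = inj₂ (inj₁ (more b))
... | inj₂ (inj₂ (i , p , q))   = inj₂ (inj₂ (suc i , p , q))
mono-cases (rise M p) with mono-cases M
... | inj₁ refl with refl ← ∷-injectiveʳ (mono-0 M) = inj₂ (inj₁ (base (s≤s z≤n) p))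
... | inj₂ (inj₁ (base _ _))    = inj₂ (inj₁ (base (s≤s z≤n) p))
-- Raising one of several copies of the top value leaves another copy strictly between 0 and the new
-- top.
... | inj₂ (inj₁ (more {r = _ ∷ _} b)) with refl ← mono-head (block-mono b) =
  inj₂ (inj₂ (suc zero , block-positive b , ≤-refl))
... | inj₂ (inj₂ (zero , _ , q))  = ⊥-elim (<-irrefl refl q)
... | inj₂ (inj₂ (suc i , p , q)) = inj₂ (inj₂ (suc i , p , m≤n⇒m≤1+n q))

two-descent : {r : Vec ℕ n} → TwoValued t r → ∃[ i ] ∃[ j ] i Fin.< j × lookup r i < lookup r j
two-descent (drop {r = _ ∷ _} _ b) with refl ← mono-head (block-mono b) =
  zero , suc zero , s≤s z≤n , block-positive b
two-descent (zero T) with i , j , i<j , p ← two-descent T = suc i , suc j , s<s i<j , p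
two-descent (peak T) with i , j , i<j , p ← two-descent T = suc i , suc j , s<s i<j , p

inversion-last : {r : Vec ℕ (suc n)} → ReverseInversion r → lookup r (fromℕ n) ≡ 0
inversion-last {n} inv = n≤0⇒n≡0 (≤-trans (inv (fromℕ n)) (≤-reflexive
  (trans (opposite-prop (fromℕ n)) (trans (cong (n ∸_) (toℕ-fromℕ n)) (n∸n≡0 n)))))

-- The initial entry of the sequence is 0, so it starts a pattern 021 as soon as
-- a positive entry follows a larger one.
max-≤ : {r : Vec ℕ (suc n)} → Valid (suc x ∷ r) → maxEntry r ≤ suc x
max-≤ {n} {x} {r} V@(_ , _ , ¬021) = ≮⇒≥ λ x<max →
  let i , eq = max-attained r
      last≡0 = inversion-last {r = r} (proj₁ (valid-tail V))
      ri≢0 : lookup r i ≢ 0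
      ri≢0 ri≡0 = n≮0 (subst (suc x <_) (trans (sym eq) ri≡0) x<max)
      -- The maximum is positive, so it does not sit at the initial position, where the entry is 0.
      i<last = ≤∧≢⇒< (≤-trans (toℕ≤pred[n] i) (≤-reflexive (sym (toℕ-fromℕ n))))
        (λ e → ri≢0 (trans (cong (lookup r) (toℕ-injective e)) last≡0))
  in ¬021 (has {i = zero} {suc i} {suc (fromℕ n)} (s≤s z≤n) (s<s i<last)
       (subst (_< suc x) (sym last≡0) (s≤s z≤n)) (subst (suc x <_) (sym eq) x<max))

-- The entries at `j` and `i` already form the 1 and the 0 of a 102, so a larger new entry would
-- complete it.
valid-∷-≤ : {r : Vec ℕ n} → Valid (x ∷ r) →
  ∀ {i j} → i Fin.< j → lookup r i < lookup r j → x ≤ lookup r j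
valid-∷-≤ (_ , ¬102 , _) i<j p = ≮⇒≥ λ q → ¬102 (has {i = zero} (s≤s z≤n) (s<s i<j) p q)

slack : m < n → n ≡ m + suc (n ∸ suc m)
slack {m} m<n = trans (sym (m+[n∸m]≡n m<n)) (sym (+-suc m _))

classify : (r : Vec ℕ (suc n)) → Valid r → Shape r
classify (x ∷ []) (inv , _) with z≤n ← inv zero = mono start
classify {suc n} (x ∷ r@(_ ∷ _)) V with classify r (valid-tail V)
classify {suc n} (x ∷ r@(_ ∷ _)) V | mono {m = m} M with m ≤? x
... | yes m≤x = mono (mono-extend M m≤x (≤-trans (proj₁ V zero) (≤-reflexive (toℕ-fromℕ (suc n)))))
classify (suc x ∷ r@(_ ∷ _)) V | mono M | no m≰x =
  ⊥-elim (m≰x (subst (_≤ suc x) (mono-max M) (max-≤ V)))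
classify (zero ∷ r@(_ ∷ _)) V | mono M | no m≰x with mono-cases M
... | inj₁ refl                 = ⊥-elim (m≰x z≤n)
... | inj₂ (inj₁ b)             = two (drop (slack (mono-< M)) b)
... | inj₂ (inj₂ (i , p , q))   =
  fall {i = zero} {suc i} (zero (mono (<⇒≤ (≤-trans (s≤s p) q)) (slack (mono-< M)) M)) (s≤s z≤n) p
    (subst (_ <_) (sym (mono-max M)) q)
classify (zero  ∷ r@(_ ∷ _)) V | two T = two (zero T)
-- A descent bounds the new entry by an earlier one, hence by the maximum; `max-≤` gives the other
-- inequality, so the new entry is a `peak`.
classify (suc x ∷ r@(_ ∷ _)) V | two T with i , j , i<j , p ← two-descent T =
  two (subst (λ y → TwoValued _ (y ∷ r)) (≤-antisym (max-≤ V) (≤-trans (valid-∷-≤ V i<j p) (max-upper r j))) (peak T))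
classify (zero  ∷ r@(_ ∷ _)) V | fall G i<j p q = fall (zero G) (s<s i<j) p q
-- The new entry would be at least the maximum and at most an entry below it.
classify (suc x ∷ r@(_ ∷ _)) V | fall G i<j p q =
  ⊥-elim (<⇒≱ q (≤-trans (max-≤ V) (valid-∷-≤ V i<j p)))

shape-avoider : {r : Vec ℕ n} → Shape r → Mono 0 r ⊎ ∃[ t ] Avoider t r
shape-avoider (mono {m = zero} M)  = inj₁ M
shape-avoider (mono {m = suc m} M) = inj₂ (_ , mono (s≤s z≤n) (slack (mono-< M)) M)
shape-avoider (two T)              = inj₂ (_ , two-avoider T)
shape-avoider (fall G _ _ _)       = inj₂ (_ , G)

-- Ranks and the final count

rank-⇔ : (e : Vec ℕ n) → rank e ≡ + t ⇔ fdes e ≡ maxEntry e + suc t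
rank-⇔ {t = t} e = mk⇔
  (λ eq → ℤ.+-injective (trans (restore (+ fdes e) (+ maxEntry e)) (trans (cong (λ z → + maxEntry e ℤ.+ (+ 1 ℤ.+ z)) eq) refl)))
  (λ eq → trans (cong (λ p → + p ℤ.- + maxEntry e ℤ.- + 1) eq) (remove (+ maxEntry e) (+ t)))
  where
  restore : ∀ p m → p ≡ m ℤ.+ (+ 1 ℤ.+ (p ℤ.- m ℤ.- + 1))
  restore = ℤ-solve-∀
  remove : ∀ m t → m ℤ.+ (+ 1 ℤ.+ t) ℤ.- m ℤ.- + 1 ≡ t
  remove = ℤ-solve-∀

avoider-⇔ : 2 + t ≤ n → (r : Vec ℕ n) → Avoider t r ⇔
  (Valid r × fdes (reverse r) ≡ maxEntry r + suc t)
avoider-⇔ {t} {suc n} t<n r = mk⇔ (λ G → avoider-valid G , avoider-fdes G) back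
  where
  back : Valid r × fdes (reverse r) ≡ maxEntry r + suc t → Avoider t r
  back (V , eq) with shape-avoider (classify r V)
  -- The zero sequence has rank one less than its length, which exceeds every admissible `t`.
  ... | inj₁ M = ⊥-elim (<-irrefl (trans (sym eq′) (mono-fdes r M)) t<n)
    where
    eq′ : fdes (reverse r) ≡ suc t
    eq′ = trans eq (cong (_+ suc t) (mono-max M))
  -- The parameter of `Avoider` is determined by the first descent and the maximum, so it equals
  -- `t`.
  ... | inj₂ (_ , G) with refl ← +-cancelˡ-≡ (maxEntry r) _ _ (trans (sym (avoider-fdes G)) eq) = G

AvoiderOfRank : ℕ → Vec ℕ n → Set
AvoiderOfRank t e =
  IsInversionSequence e ×
  Avoids e (1 ∷ 0 ∷ 2 ∷ []) ×
  Avoids e (0 ∷ 2 ∷ 1 ∷ []) ×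
  rank e ≡ + t

avoider-reverse : 2 + t ≤ n → (r : Vec ℕ n) → Avoider t r ⇔
  AvoiderOfRank t (reverse r)
avoider-reverse {t} t<n r = mk⇔
  (λ G → let (inv , ¬102 , ¬021) , eq = to (avoider-⇔ t<n r) G in
    from (inversion-reverse r) inv
    , (λ c → ¬102 (to (contains-102 r) c))
    , (λ c → ¬021 (to (contains-021 r) c))
    , from (rank-⇔ (reverse r)) (trans eq (cong (_+ suc t) (sym (max-reverse r)))))
  (λ (inv , ¬102 , ¬021 , eq) → from (avoider-⇔ t<n r)
    ((to (inversion-reverse r) inv
      , (λ h → ¬102 (from (contains-102 r) h))
      , (λ h → ¬021 (from (contains-021 r) h)))
    , trans (to (rank-⇔ (reverse r)) eq) (cong (_+ suc t) (max-reverse r))))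

rank-cardinality : ∀ t s n → n ≡ suc s + suc t →
  HasCardinality (AvoiderOfRank {n} t) (avoider-count t (suc s))
rank-cardinality t s n refl =
  cardinality-⇔ (λ e → mk⇔ join (λ p → reverse e
    , from (avoider-reverse t<n (reverse e)) (subst (AvoiderOfRank t) (sym (reverse-involutive e)) p)
    , sym (reverse-involutive e)))
    (cardinality-image reverse-injective (avoider-cardinality t (suc s) n refl))
  where
  t<n : 2 + t ≤ n
  t<n = s≤s (m≤n+m (suc t) s)
  join : {e : Vec ℕ n} → Image reverse (Avoider t) e → AvoiderOfRank t e
  join (r , G , refl) = to (avoider-reverse t<n r) G

-- `k` stands for `n ∸ t`: matching it with `suc (suc s)` lets the truncated subtractions in the
-- closed form compute.
rank-count : ∀ t k n → 2 ≤ k → n ≡ k + t →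
  ∃[ N ]
    HasCardinality (AvoiderOfRank {n} t) N ×
    ι N ≡ ι (t + 1) ℚ.* (ι (2 ^ (k ∸ 2)) ℚ.- ι (k ∸ 1) ℚ.+ sumFrom1To (k ∸ 1) (term t))
rank-count t (suc (suc s)) n (s≤s (s≤s _)) eq =
  avoider-count t (suc s)
  , rank-cardinality t s n (trans eq (cong suc (sym (+-suc s t))))
  , trans (avoider-count-formula t s) (cong (λ u → ι u ℚ.* (ι (2 ^ s) ℚ.- ι (suc s) ℚ.+ sumFrom1To (suc s) (term t)))
      (+-comm 1 t))

proposition5p7 : ∀ (n t : ℕ) → 2 ≤ n → t ≤ n ∸ 2 →
    ∃[ N ]
    HasCardinality
    (λ (e : Vec ℕ n) →
    IsInversionSequence e ×
    Avoids e (1 ∷ 0 ∷ 2 ∷ []) ×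
    Avoids e (0 ∷ 2 ∷ 1 ∷ []) ×
    rank e ≡ + t)
    N ×
    fromℤ (+ N) ≡
    fromℤ (+ (t + 1)) ℚ.*
    (fromℤ (+ (2 ^ (n ∸ t ∸ 2))) ℚ.- fromℤ (+ (n ∸ t ∸ 1))
    ℚ.+ sumFrom1To (n ∸ t ∸ 1)
    (λ m → (+ 1 / suc (m + t)) ℚ.* fromℤ (+ ((2 * m + t) C m))))
proposition5p7 n t 2≤n t≤n∸2 = rank-count t (n ∸ t) n
  (m+n≤o⇒m≤o∸n 2 (subst (_≤ n) (+-comm t 2) t+2≤n))
  (sym (m∸n+n≡m (m+n≤o⇒m≤o t t+2≤n)))
  where
  t+2≤n : t + 2 ≤ n
  t+2≤n = m≤o∸n⇒m+n≤o t 2≤n t≤n∸2
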